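{- For all integers $N,k,n\geqslant 0$, $$\sum_{j=0}^{\lfloor k/4 \rfloor} \overline{p}_4\Bigg( N,\;N+1-k+4j,\;j,\;k-4j,\;n-\binom{k-4j}{2}\Bigg) =\sum_{j=0}^{\lfloor k/2 \rfloor} (-1)^j\, \overline{p}_2\left( N,\,N,\,j,\,k-2j,\,n\right).$$
   Context: Assume there are positive integers of two kinds, $\lambda$ (first kind) and $\overline{\lambda}$ (second kind). For an integer $r\geqslant 1$ and integers $N_1,N_2,k_1,k_2,n\geqslant 0$, $\overline{p}_r(N_1,N_2,k_1,k_2,n)$ denotes the number of partitions of $n$ into parts of two kinds with at most $k_1$ parts of the first kind, each divisible by $r$ and less than or equal to $N_1r$, and at most $k_2$ parts of the second kind, each less than or equal to $N_2$ (the order of the parts is irrelevant; the empty partition is the unique partition of $0$). For example $\overline{p}_2(2,3,2,2,4)=6$, the partitions being $4$, $2+2$, $2+\overline{2}$, $2+\overline{1}+\overline{1}$, $\overline{3}+\overline{1}$, $\overline{2}+\overline{2}$. Convention: $\overline{p}_r(N_1,N_2,k_1,k_2,n)=0$ whenever any of $N_1,N_2,k_1,k_2,n$ is negative. Also $\binom{m}{2}=m(m-1)/2$. -}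

module Defs where

open import Data.Integer.Base as ℤ using (ℤ; +_; 0ℤ; 1ℤ)
open import Data.List.Base
  using (List; []; _∷_; length; map; foldr; filter; upTo; cartesianProduct; cartesianProductWith)
open import Data.List.Membership.Propositional using (_∈_)
open import Data.List.Membership.Propositional.Properties
  using (∈-upTo⁺; ∈-cartesianProductWith⁺; ∈-cartesianProductWith⁻; ∈-cartesianProduct⁺; ∈-filter⁺; ∈-filter⁻)
open import Data.List.Properties using (∷-injective)
open import Data.List.Relation.Unary.All as All using (All; []; _∷_)
open import Data.List.Relation.Unary.AllPairs using ([]; _∷_)
open import Data.List.Relation.Unary.Any using (here; there)
open import Data.List.Relation.Unary.Linked as Linked using (Linked)
open import Data.List.Relation.Unary.Unique.Propositional using (Unique)
import Data.List.Relation.Unary.Unique.Propositional.Properties as Unique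
open import Data.Nat.Base using (ℕ; zero; suc; NonZero; _+_; _*_; _≤_; _<_; _≥_; s≤s)
open import Data.Nat.Divisibility using (_∣_; _∣?_)
open import Data.Nat.ListAction using (sum)
open import Data.Nat.Properties using (_≤?_; _<?_; _≥?_; _≟_)
open import Data.Product.Base using (_×_; _,_; proj₂)
open import Function.Bundles using (_⇔_; mk⇔)
open import Relation.Binary.PropositionalEquality using (_≡_; refl)
open import Relation.Nullary.Decidable using (_×-dec_)
open import Relation.Nullary.Negation.Core using (¬_)
open import Relation.Unary using (Decidable)

-- The order of parts is irrelevant, so a multiset of parts is represented by
-- its unique weakly decreasing listing.
IsPartition : List ℕ → Set
IsPartition parts = Linked _≥_ parts × All (0 <_) parts

isPartition? : Decidable IsPartition
isPartition? parts = Linked.linked? _≥?_ parts ×-dec All.all? (0 <?_) parts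

-- In (α , β), α lists the parts of the first kind and β those of the second.
IsTwoKindPartition : (r N₁ N₂ k₁ k₂ n : ℕ) → List ℕ × List ℕ → Set
IsTwoKindPartition r N₁ N₂ k₁ k₂ n (α , β) =
    (IsPartition α × length α ≤ k₁ × All (r ∣_) α × All (_≤ N₁ * r) α)
  × (IsPartition β × length β ≤ k₂ × All (_≤ N₂) β)
  × sum α + sum β ≡ n

isTwoKindPartition? : ∀ r N₁ N₂ k₁ k₂ n → Decidable (IsTwoKindPartition r N₁ N₂ k₁ k₂ n)
isTwoKindPartition? r N₁ N₂ k₁ k₂ n (α , β) =
        (isPartition? α ×-dec length α ≤? k₁ ×-dec All.all? (r ∣?_) α ×-dec All.all? (_≤? N₁ * r) α)
  ×-dec (isPartition? β ×-dec length β ≤? k₂ ×-dec All.all? (_≤? N₂) β)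
  ×-dec (sum α + sum β ≟ n)

-- All lists of length at most k with entries at most N.
boundedLists : (N k : ℕ) → List (List ℕ)
boundedLists N zero    = [] ∷ []
boundedLists N (suc k) = [] ∷ cartesianProductWith _∷_ (upTo (suc N)) (boundedLists N k)

twoKindPartitions : (r N₁ N₂ k₁ k₂ n : ℕ) → List (List ℕ × List ℕ)
twoKindPartitions r N₁ N₂ k₁ k₂ n =
  filter (isTwoKindPartition? r N₁ N₂ k₁ k₂ n)
         (cartesianProduct (boundedLists (N₁ * r) k₁) (boundedLists N₂ k₂))

p̄ : (r : ℕ) .{{_ : NonZero r}} (N₁ N₂ k₁ k₂ n : ℤ) → ℕ
p̄ r (+ N₁) (+ N₂) (+ k₁) (+ k₂) (+ n) = length (twoKindPartitions r N₁ N₂ k₁ k₂ n)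
p̄ r _      _      _      _      _     = 0

-- The division is exact, since m (m - 1) is even.
binom₂ : ℤ → ℤ
binom₂ m = (m ℤ.* (m ℤ.- 1ℤ)) ℤ./ℕ 2

-- The upper limit is included: Σ[ j ≤ m ] f j = f 0 + … + f m.
sumTo : ℕ → (ℕ → ℤ) → ℤ
sumTo m f = foldr ℤ._+_ 0ℤ (map f (upTo (suc m)))

infix 5 sumTo
syntax sumTo m (λ j → t) = Σ[ j ≤ m ] t

-- The list twoKindPartitions contains every two-kind partition, and each only
-- once, so its length is the number of such partitions.

∈-boundedLists : ∀ {N k xs} → length xs ≤ k → All (_≤ N) xs → xs ∈ boundedLists N k
∈-boundedLists {k = zero}  {[]}     _       _        = here refl
∈-boundedLists {k = suc k} {[]}     _       _        = here refl
∈-boundedLists {k = suc k} {x ∷ xs} (s≤s l) (p ∷ ps) =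
  there (∈-cartesianProductWith⁺ _∷_ (∈-upTo⁺ (s≤s p)) (∈-boundedLists l ps))

boundedLists-unique : ∀ N k → Unique (boundedLists N k)
boundedLists-unique N zero    = [] ∷ []
boundedLists-unique N (suc k) =
    All.tabulate (λ { v∈ refl → []∉ v∈ })
  ∷ Unique.cartesianProductWith⁺ _∷_ ∷-injective (Unique.upTo⁺ (suc N)) (boundedLists-unique N k)
  where
  []∉ : ¬ [] ∈ cartesianProductWith _∷_ (upTo (suc N)) (boundedLists N k)
  []∉ v∈ with ∈-cartesianProductWith⁻ _∷_ (upTo (suc N)) (boundedLists N k) v∈
  ... | _ , _ , _ , _ , ()

∈-twoKindPartitions : ∀ {r N₁ N₂ k₁ k₂ n αβ} →
  αβ ∈ twoKindPartitions r N₁ N₂ k₁ k₂ n ⇔ IsTwoKindPartition r N₁ N₂ k₁ k₂ n αβ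
∈-twoKindPartitions {r} {N₁} {N₂} {k₁} {k₂} {n} = mk⇔
  (λ αβ∈ → proj₂ (∈-filter⁻ P? {xs = candidates} αβ∈))
  (λ { p@((_ , l₁ , _ , b₁) , (_ , l₂ , b₂) , _) →
       ∈-filter⁺ P? (∈-cartesianProduct⁺ (∈-boundedLists l₁ b₁) (∈-boundedLists l₂ b₂)) p })
  where
  P? = isTwoKindPartition? r N₁ N₂ k₁ k₂ n
  candidates = cartesianProduct (boundedLists (N₁ * r) k₁) (boundedLists N₂ k₂)

twoKindPartitions-unique : ∀ r N₁ N₂ k₁ k₂ n → Unique (twoKindPartitions r N₁ N₂ k₁ k₂ n)
twoKindPartitions-unique r N₁ N₂ k₁ k₂ n =
  Unique.filter⁺ (isTwoKindPartition? r N₁ N₂ k₁ k₂ n)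
    (Unique.cartesianProduct⁺ (boundedLists-unique (N₁ * r) k₁) (boundedLists-unique N₂ k₂))

_ : p̄ 2 (+ 2) (+ 3) (+ 2) (+ 2) (+ 4) ≡ 6
_ = refl

{-# OPTIONS --safe #-}
module Submission where

-- Both sides are coefficients of zᵏqⁿ, the left one in
-- ∏_{i≤N} (1 + z qⁱ) / (1 - z⁴ q⁴ⁱ) and the right one in
-- ∏_{i≤N} 1 / ((1 - z qⁱ)(1 + z² q²ⁱ)). The two products agree because
-- (1 + x)(1 - x)(1 + x²) = 1 - x⁴. On coefficients, each factor is a recurrence
-- obtained by removing a largest admissible part from a partition; the
-- recurrences for both sides combine to the same one, and its solution is unique.

open import Defs
open import Algebra.Properties.AbelianGroup using (∙-cancelʳ)
open import Data.Empty using (⊥)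
open import Data.Integer.Base
  using (ℤ; 0ℤ; 1ℤ; -1ℤ; +_; -[1+_]; -_; _+_; _-_; _*_; _/ℕ_; _^_; ∣_∣; _≤_; _<_; +≤+; +<+; -<+; NonNegative)
import Data.Integer.Properties as ℤ
open import Data.Integer.Tactic.RingSolver using (solve-∀)
open import Data.List.Base using (List; []; _∷_; _++_; drop; foldr; length; map; upTo)
open import Data.List.Membership.Propositional using (_∈_)
open import Data.List.Membership.Propositional.Properties
  using (∈-++⁺ˡ; ∈-++⁺ʳ; ∈-++⁻; ∈-map⁺; ∈-map⁻)
open import Data.List.Membership.Propositional.Properties.WithK using (unique∧set⇒bag)
open import Data.List.Properties using (length-++; length-map; map-cong; map-upTo)
open import Data.List.Relation.Binary.BagAndSetEquality using (∼bag⇒↭)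
open import Data.List.Relation.Binary.Permutation.Propositional.Properties using (↭-length)
open import Data.List.Relation.Unary.All as All using (All; []; _∷_)
open import Data.List.Relation.Unary.AllPairs using ([])
open import Data.List.Relation.Unary.Linked as Linked using (Linked; []; [-]; _∷_)
open import Data.List.Relation.Unary.Linked.Properties using (Linked⇒All)
open import Data.List.Relation.Unary.Unique.Propositional using (Unique)
import Data.List.Relation.Unary.Unique.Propositional.Properties as Unique
import Data.Nat.Base as ℕ
open import Data.Nat.Base using (ℕ; zero; suc; NonZero; z≤n; s≤s)
import Data.Nat.Divisibility as ℕ
open import Data.Nat.Divisibility using (divides; n∣m*n; 1∣_)
open import Data.Nat.DivMod using (_/_; m≡m%n+[m/n]*n; m%n<n; +-distrib-/-∣ʳ; m*n/n≡m)
open import Data.Nat.ListAction using (sum)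
import Data.Nat.Properties as ℕ
import Data.Nat.Tactic.RingSolver as ℕ
open import Data.Product.Base using (_×_; _,_; ∃-syntax; map₂; swap)
open import Data.Sum.Base using (_⊎_; inj₁; inj₂)
open import Function.Base using (_∘_; case_of_)
open import Function.Bundles using (mk⇔; Equivalence)
open import Function.Definitions using (Injective)
open import Relation.Binary.PropositionalEquality
open import Relation.Nullary.Decidable using (yes; no)
open import Relation.Nullary.Negation using (¬_; contradiction)
open import Relation.Unary using (_⊆_)
open ≡-Reasoning

-- Partitions with bounded parts and bounded length

-- Integer arguments, with no solutions when one is negative, mirror the convention for `p̄`, so the
-- recurrences hold without side conditions.
IsBoundedPartition : ℕ → ℤ → ℤ → List ℕ → Set
IsBoundedPartition r (+ N) (+ k) α =
  IsPartition α × length α ℕ.≤ k × All (r ℕ.∣_) α × All (ℕ._≤ N ℕ.* r) α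
IsBoundedPartition r _ _ _ = ⊥

module _ {r : ℕ} where

  boundedPartition-[] : ∀ N k → IsBoundedPartition r (+ N) (+ k) []
  boundedPartition-[] _ _ = ([] , []) , z≤n , [] , []

  noParts⇒≡[] : ∀ {N α} → IsBoundedPartition r N 0ℤ α → α ≡ []
  noParts⇒≡[] {+ N} {[]} _ = refl

  zeroBound⇒≡[] : ∀ {k α} → IsBoundedPartition r 0ℤ k α → α ≡ []
  zeroBound⇒≡[] {+ k} {[]}    _                                  = refl
  zeroBound⇒≡[] {+ k} {_ ∷ _} ((_ , 0<a ∷ _) , _ , _ , a≤0 ∷ _) = contradiction a≤0 (ℕ.<⇒≱ 0<a)

  bound-suc : ∀ N k {α} → IsBoundedPartition r (+ N) k α → IsBoundedPartition r (+ suc N) k α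
  bound-suc N (+ k) (p , l , d , b) = p , l , d , All.map (λ a≤ → ℕ.m≤n⇒m≤o+n r a≤) b

module _ {r : ℕ} .{{_ : NonZero r}} where

  largest∉ : ∀ N k {α} → ¬ IsBoundedPartition r (+ N) k (suc N ℕ.* r ∷ α)
  largest∉ N (+ k) (_ , _ , _ , b ∷ _) = ℕ.<⇒≱ (ℕ.m<n+m (N ℕ.* r) (ℕ.>-nonZero⁻¹ r)) b

  prependLargest : ∀ N k {α} → IsBoundedPartition r (+ suc N) (k - 1ℤ) α →
                   IsBoundedPartition r (+ suc N) k (suc N ℕ.* r ∷ α)
  -- For `k ≤ 0` the hypothesis is empty, since `k - 1ℤ` is negative.
  prependLargest N (+ suc k) ((p , q) , l , d , b) =
    (linked p b , ℕ.≤-trans (ℕ.>-nonZero⁻¹ r) (ℕ.m≤m+n r (N ℕ.* r)) ∷ q) ,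
    s≤s l , n∣m*n (suc N) ∷ d , ℕ.≤-refl ∷ b
    where
    linked : ∀ {x α} → Linked ℕ._≥_ α → All (ℕ._≤ x) α → Linked ℕ._≥_ (x ∷ α)
    linked []       _       = [-]
    linked [-]      (b ∷ _) = b ∷ [-]
    linked (p ∷ ps) (b ∷ _) = b ∷ p ∷ ps

  -- The parts decrease, so the head `c * r` decides: if `c` is not `suc N`, then it is at most `N`,
  -- and `N * r` bounds all parts.
  splitLargest : ∀ N k {α} → IsBoundedPartition r (+ suc N) k α →
                 IsBoundedPartition r (+ N) k α ⊎
                 ∃[ α′ ] (α ≡ suc N ℕ.* r ∷ α′ × IsBoundedPartition r (+ suc N) (k - 1ℤ) α′)
  splitLargest N (+ k) {[]} _ = inj₁ (boundedPartition-[] N k)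
  splitLargest N (+ suc k) {a ∷ α} ((p , q ∷ qs) , s≤s l , divides c refl ∷ ds , b ∷ bs)
    with c ℕ.≟ suc N
  ... | yes refl = inj₂ (α , refl , (Linked.tail p , qs) , l , ds , bs)
  ... | no c≢ = inj₁ ((p , q ∷ qs) , s≤s l , divides c refl ∷ ds ,
                      Linked⇒All (λ i≥j j≥k → ℕ.≤-trans j≥k i≥j) a≤ p)
    where
    a≤ : c ℕ.* r ℕ.≤ N ℕ.* r
    a≤ = ℕ.*-monoˡ-≤ r (ℕ.s≤s⁻¹ (ℕ.≤∧≢⇒< (ℕ.*-cancelʳ-≤ c (suc N) r b) c≢))

-- Counting by lists without repetition

module _ {A : Set} where

  record _HasSize_ (P : A → Set) (n : ℕ) : Set where
    field
      elements : List A
      unique   : Unique elements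
      sound    : ∀ {x} → x ∈ elements → P x
      complete : ∀ {x} → P x → x ∈ elements
      size     : length elements ≡ n
  open _HasSize_

  -- Repetition-free lists with the same members are permutations of each other, so equality of
  -- counts reduces to two implications.
  hasSize-cong : ∀ {P Q : A → Set} {m n} → P HasSize m → Q HasSize n → P ⊆ Q → Q ⊆ P → m ≡ n
  hasSize-cong p q P⊆Q Q⊆P = begin
    _                   ≡⟨ size p ⟨
    length (elements p) ≡⟨ ↭-length (∼bag⇒↭ (unique∧set⇒bag (unique p) (unique q)
                             (mk⇔ (complete q ∘ P⊆Q ∘ sound p) (complete p ∘ Q⊆P ∘ sound q)))) ⟩
    length (elements q) ≡⟨ size q ⟩
    _                   ∎

  ∅-hasSize : (λ (_ : A) → ⊥) HasSize 0
  ∅-hasSize = record { elements = [] ; unique = [] ; sound = λ () ; complete = λ () ; size = refl }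

  -- The pattern of a split by the largest part: `P` describes the pairs without that part, and `f`
  -- adds one copy of it to a pair satisfying `Q`.
  hasSize-⊎-image : ∀ {P Q : A → Set} {m n} (f : A → A) → Injective _≡_ _≡_ f → (∀ {x} → ¬ P (f x)) →
                    P HasSize m → Q HasSize n →
                    (λ x → P x ⊎ ∃[ y ] (x ≡ f y × Q y)) HasSize (m ℕ.+ n)
  hasSize-⊎-image f f-inj disjoint p q = record
    { elements = elements p ++ map f (elements q)
    ; unique   = Unique.++⁺ (unique p) (Unique.map⁺ f-inj (unique q)) λ (x∈p , x∈q) →
                   case ∈-map⁻ f x∈q of λ { (_ , _ , refl) → disjoint (sound p x∈p) }
    ; sound    = λ x∈ → case ∈-++⁻ (elements p) x∈ of λ
                   { (inj₁ x∈p) → inj₁ (sound p x∈p)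
                   ; (inj₂ x∈q) → inj₂ (map₂ (map₂ (sound q)) (map₂ swap (∈-map⁻ f x∈q))) }
    ; complete = λ { (inj₁ Px)              → ∈-++⁺ˡ (complete p Px)
                   ; (inj₂ (_ , refl , Qy)) → ∈-++⁺ʳ (elements p) (∈-map⁺ f (complete q Qy)) }
    ; size     = trans (length-++ (elements p)) (cong₂ ℕ._+_ (size p) (trans (length-map f (elements q)) (size q)))
    }

-- Recurrences and degenerate cases of `p̄`

-- The second kind is the case `r = 1`, so the same lemmas serve both kinds. The sum is compared in
-- `ℤ`, which leaves no pairs for negative `n`.
IsPair : (r : ℕ) (N₁ N₂ k₁ k₂ n : ℤ) → List ℕ × List ℕ → Set
IsPair r N₁ N₂ k₁ k₂ n (α , β) =
  IsBoundedPartition r N₁ k₁ α × IsBoundedPartition 1 N₂ k₂ β × + sum α + + sum β ≡ n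

p̄-hasSize : ∀ r .{{_ : NonZero r}} N₁ N₂ k₁ k₂ n →
            IsPair r N₁ N₂ k₁ k₂ n HasSize p̄ r N₁ N₂ k₁ k₂ n
p̄-hasSize r (+ N₁) (+ N₂) (+ k₁) (+ k₂) (+ n) = record
  { elements = twoKindPartitions r N₁ N₂ k₁ k₂ n
  ; unique   = twoKindPartitions-unique r N₁ N₂ k₁ k₂ n
  ; sound    = λ αβ∈ → case Equivalence.to (∈-twoKindPartitions {r} {N₁}) αβ∈ of λ
      { (α-ok , (p , l , b) , e) →
        α-ok ,
        (p , l , All.universal 1∣_ _ , subst (λ N → All (ℕ._≤ N) _) (sym (ℕ.*-identityʳ N₂)) b) , cong +_ e }
  ; complete = λ { (α-ok , (p , l , _ , b) , e) → Equivalence.from (∈-twoKindPartitions {r} {N₁})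
      (α-ok , (p , l , subst (λ N → All (ℕ._≤ N) _) (ℕ.*-identityʳ N₂) b) , ℤ.+-injective e) }
  ; size     = refl
  }
p̄-hasSize r (+ N₁) (+ N₂) (+ k₁) (+ k₂) -[1+ _ ] =
  record { elements = [] ; unique = [] ; sound = λ () ; complete = λ { (_ , _ , ()) } ; size = refl }
p̄-hasSize r (+ N₁) (+ N₂) (+ k₁) -[1+ _ ] _ =
  record { elements = [] ; unique = [] ; sound = λ () ; complete = λ { (_ , () , _) } ; size = refl }
p̄-hasSize r (+ N₁) (+ N₂) -[1+ _ ] _ _ =
  record { elements = [] ; unique = [] ; sound = λ () ; complete = λ { (() , _) } ; size = refl }
p̄-hasSize r (+ N₁) -[1+ _ ] _ _ _ =
  record { elements = [] ; unique = [] ; sound = λ () ; complete = λ { (_ , () , _) } ; size = refl }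
p̄-hasSize r -[1+ _ ] _ _ _ _ =
  record { elements = [] ; unique = [] ; sound = λ () ; complete = λ { (() , _) } ; size = refl }

m+[n-m]≡n : ∀ m n → m + (n - m) ≡ n
m+[n-m]≡n = solve-∀

-- Either the largest admissible part occurs, and one copy of it can be
-- removed, or the bound on the parts can be lowered.

p̄-split₁ : ∀ r .{{_ : NonZero r}} N₁ N₂ k₁ k₂ n →
           p̄ r (+ suc N₁) N₂ k₁ k₂ n ≡
           p̄ r (+ N₁) N₂ k₁ k₂ n ℕ.+ p̄ r (+ suc N₁) N₂ (k₁ - 1ℤ) k₂ (n - + (suc N₁ ℕ.* r))
p̄-split₁ r N₁ N₂ k₁ k₂ n = hasSize-cong (p̄-hasSize r (+ suc N₁) N₂ k₁ k₂ n)
  (hasSize-⊎-image (λ (α , β) → (suc N₁ ℕ.* r ∷ α , β)) (λ { refl → refl }) (λ (a , _) → largest∉ N₁ k₁ a)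
    (p̄-hasSize r (+ N₁) N₂ k₁ k₂ n)
    (p̄-hasSize r (+ suc N₁) N₂ (k₁ - 1ℤ) k₂ (n - + (suc N₁ ℕ.* r))))
  (λ { {_ , β} (a , b , refl) → case splitLargest N₁ k₁ a of λ
       { (inj₁ a′)               → inj₁ (a′ , b , refl)
       ; (inj₂ (α′ , refl , a′)) →
           inj₂ ((α′ , β) , refl , a′ , b , remove (+ (suc N₁ ℕ.* r)) (+ sum α′) (+ sum β)) } })
  (λ { (inj₁ (a , b , e))                  → bound-suc N₁ k₁ a , b , e
     ; (inj₂ ((α , β) , refl , a , b , e)) →
         prependLargest N₁ k₁ a , b , insert (+ (suc N₁ ℕ.* r)) (+ sum α) (+ sum β) e })
  where
  remove : ∀ m a b → a + b ≡ m + a + b - m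
  remove = solve-∀
  insert : ∀ m a b → a + b ≡ n - m → m + a + b ≡ n
  insert m a b e = trans (ℤ.+-assoc m a b) (trans (cong (λ x → m + x) e) (m+[n-m]≡n m n))

p̄-split₂ : ∀ r .{{_ : NonZero r}} N₁ N₂ k₁ k₂ n →
           p̄ r N₁ (+ suc N₂) k₁ k₂ n ≡
           p̄ r N₁ (+ N₂) k₁ k₂ n ℕ.+ p̄ r N₁ (+ suc N₂) k₁ (k₂ - 1ℤ) (n - + suc N₂)
-- For `r = 1` the largest part appears as `suc N₂ * 1`; the equation is proved in this form and
-- then transported.
p̄-split₂ r N₁ N₂ k₁ k₂ n = subst
  (λ m → p̄ r N₁ (+ suc N₂) k₁ k₂ n ≡
         p̄ r N₁ (+ N₂) k₁ k₂ n ℕ.+ p̄ r N₁ (+ suc N₂) k₁ (k₂ - 1ℤ) (n - + m))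
  (ℕ.*-identityʳ (suc N₂))
  (hasSize-cong (p̄-hasSize r N₁ (+ suc N₂) k₁ k₂ n)
    (hasSize-⊎-image (λ (α , β) → (α , suc N₂ ℕ.* 1 ∷ β)) (λ { refl → refl }) (λ (_ , b , _) → largest∉ N₂ k₂ b)
      (p̄-hasSize r N₁ (+ N₂) k₁ k₂ n)
      (p̄-hasSize r N₁ (+ suc N₂) k₁ (k₂ - 1ℤ) (n - + (suc N₂ ℕ.* 1))))
    (λ { {α , _} (a , b , refl) → case splitLargest N₂ k₂ b of λ
         { (inj₁ b′)               → inj₁ (a , b′ , refl)
         ; (inj₂ (β′ , refl , b′)) →
             inj₂ ((α , β′) , refl , a , b′ , remove (+ (suc N₂ ℕ.* 1)) (+ sum α) (+ sum β′)) } })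
    (λ { (inj₁ (a , b , e))                  → a , bound-suc N₂ k₂ b , e
       ; (inj₂ ((α , β) , refl , a , b , e)) →
           a , prependLargest N₂ k₂ b , insert (+ (suc N₂ ℕ.* 1)) (+ sum α) (+ sum β) e }))
  where
  remove : ∀ m a b → a + b ≡ a + (m + b) - m
  remove = solve-∀
  swap-front : ∀ m a b → a + (m + b) ≡ m + (a + b)
  swap-front = solve-∀
  insert : ∀ m a b → a + b ≡ n - m → a + (m + b) ≡ n
  insert m a b e = trans (swap-front m a b) (trans (cong (λ x → m + x) e) (m+[n-m]≡n m n))

-- `p̄` matches from the left and is stuck on the variable `N₁`; comparison with the empty predicate
-- avoids splitting on every argument.
p̄-negativeParts₂ : ∀ r .{{_ : NonZero r}} N₁ N₂ k₁ i n → p̄ r N₁ N₂ k₁ -[1+ i ] n ≡ 0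
p̄-negativeParts₂ r N₁ N₂ k₁ i n = hasSize-cong (p̄-hasSize r N₁ N₂ k₁ -[1+ i ] n) ∅-hasSize
  (λ { (_ , b , _) → noParts N₂ b }) λ ()
  where
  noParts : ∀ N {α} → ¬ IsBoundedPartition 1 N -[1+ i ] α
  noParts (+ _) ()

p̄-negativeBound₂ : ∀ r .{{_ : NonZero r}} N₁ i k₁ k₂ n → p̄ r N₁ -[1+ i ] k₁ k₂ n ≡ 0
p̄-negativeBound₂ r N₁ i k₁ k₂ n = hasSize-cong (p̄-hasSize r N₁ -[1+ i ] k₁ k₂ n) ∅-hasSize
  (λ { (_ , () , _) }) λ ()

emptyOnly : ∀ r r′ N k N′ k′ {α} → N ≡ 0 ⊎ k ≡ 0 →
            IsBoundedPartition r (+ N) (+ k) α → IsBoundedPartition r′ (+ N′) (+ k′) α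
emptyOnly r r′ N k N′ k′ (inj₁ refl) a with refl ← zeroBound⇒≡[] {k = + k} a = boundedPartition-[] N′ k′
emptyOnly r r′ N k N′ k′ (inj₂ refl) a with refl ← noParts⇒≡[] {N = + N} a = boundedPartition-[] N′ k′

-- On both sides only the empty partition of the first kind remains. This lets `N` change in the
-- terms with `j = 0`, `j` change when `N = 0`, and `r` pass from 4 to 2 in the base case.
p̄-emptyOnly₁ : ∀ r r′ .{{_ : NonZero r}} .{{_ : NonZero r′}} N N₂ k k₂ n N′ k′ →
               N ≡ 0 ⊎ k ≡ 0 → N′ ≡ 0 ⊎ k′ ≡ 0 →
               p̄ r (+ N) N₂ (+ k) k₂ n ≡ p̄ r′ (+ N′) N₂ (+ k′) k₂ n
p̄-emptyOnly₁ r r′ N N₂ k k₂ n N′ k′ z z′ =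
  hasSize-cong (p̄-hasSize r (+ N) N₂ (+ k) k₂ n) (p̄-hasSize r′ (+ N′) N₂ (+ k′) k₂ n)
    (λ (a , b , e) → emptyOnly r r′ N k N′ k′ z a , b , e)
    (λ (a , b , e) → emptyOnly r′ r N′ k′ N k z′ a , b , e)

p̄-emptyOnly₂ : ∀ r .{{_ : NonZero r}} N₁ N k₁ k n N′ k′ →
               N ≡ 0 ⊎ k ≡ 0 → N′ ≡ 0 ⊎ k′ ≡ 0 →
               p̄ r N₁ (+ N) k₁ (+ k) n ≡ p̄ r N₁ (+ N′) k₁ (+ k′) n
p̄-emptyOnly₂ r N₁ N k₁ k n N′ k′ z z′ =
  hasSize-cong (p̄-hasSize r N₁ (+ N) k₁ (+ k) n) (p̄-hasSize r N₁ (+ N′) k₁ (+ k′) n)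
    (λ (a , b , e) → a , emptyOnly 1 1 N k N′ k′ z b , e)
    (λ (a , b , e) → a , emptyOnly 1 1 N′ k′ N k z′ b , e)

-- Finite sums

sumTo-suc : ∀ m f → sumTo (suc m) f ≡ f 0 + sumTo m (f ∘ suc)
sumTo-suc m f = cong (λ fs → f 0 + foldr _+_ 0ℤ fs)
  (trans (cong (drop 1) (map-upTo f (suc (suc m)))) (sym (map-upTo (f ∘ suc) (suc m))))

sumTo-cong : ∀ m {f g} → (∀ j → f j ≡ g j) → sumTo m f ≡ sumTo m g
sumTo-cong m f≡g = cong (foldr _+_ 0ℤ) (map-cong f≡g (upTo (suc m)))

sumTo-+ : ∀ m f g → sumTo m (λ j → f j + g j) ≡ sumTo m f + sumTo m g
sumTo-+ zero    f g = rearrange (f 0) (g 0)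
  where
  rearrange : ∀ x y → x + y + 0ℤ ≡ (x + 0ℤ) + (y + 0ℤ)
  rearrange = solve-∀
sumTo-+ (suc m) f g = begin
  sumTo (suc m) (λ j → f j + g j)                             ≡⟨ sumTo-suc m (λ j → f j + g j) ⟩
  f 0 + g 0 + sumTo m (λ j → f (suc j) + g (suc j))           ≡⟨ cong (λ x → f 0 + g 0 + x) (sumTo-+ m (f ∘ suc) (g ∘ suc)) ⟩
  f 0 + g 0 + (sumTo m (f ∘ suc) + sumTo m (g ∘ suc))         ≡⟨ rearrange (f 0) (g 0) _ _ ⟩
  (f 0 + sumTo m (f ∘ suc)) + (g 0 + sumTo m (g ∘ suc))       ≡⟨ cong₂ _+_ (sumTo-suc m f) (sumTo-suc m g) ⟨
  sumTo (suc m) f + sumTo (suc m) g                           ∎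
  where
  rearrange : ∀ x y u v → x + y + (u + v) ≡ (x + u) + (y + v)
  rearrange = solve-∀

sumTo-0 : ∀ m {f} → (∀ j → f j ≡ 0ℤ) → sumTo m f ≡ 0ℤ
sumTo-0 zero        f≡0 = trans (ℤ.+-identityʳ _) (f≡0 0)
sumTo-0 (suc m) {f} f≡0 = trans (sumTo-suc m f) (cong₂ _+_ (f≡0 0) (sumTo-0 m (f≡0 ∘ suc)))

-- Only zero terms lie between the two limits. This is how the quotients `k / 4` and `k / 2` give
-- way to one uniform limit.
sumTo-bound : ∀ m m′ f → (∀ j → m ℕ.< j → f j ≡ 0ℤ) → (∀ j → m′ ℕ.< j → f j ≡ 0ℤ) →
              sumTo m f ≡ sumTo m′ f
sumTo-bound zero    zero     f z z′ = refl
sumTo-bound zero    (suc m′) f z z′ =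
  sym (trans (sumTo-suc m′ f) (cong (λ x → f 0 + x) (sumTo-0 m′ λ j → z (suc j) (s≤s z≤n))))
sumTo-bound (suc m) zero     f z z′ =
  trans (sumTo-suc m f) (cong (λ x → f 0 + x) (sumTo-0 m λ j → z′ (suc j) (s≤s z≤n)))
sumTo-bound (suc m) (suc m′) f z z′ = begin
  sumTo (suc m) f              ≡⟨ sumTo-suc m f ⟩
  f 0 + sumTo m (f ∘ suc)      ≡⟨ cong (λ x → f 0 + x) (sumTo-bound m m′ (f ∘ suc)
                                    (λ j → z (suc j) ∘ s≤s) (λ j → z′ (suc j) ∘ s≤s)) ⟩
  f 0 + sumTo m′ (f ∘ suc)     ≡⟨ sumTo-suc m′ f ⟨
  sumTo (suc m′) f             ∎

-- Sums over all `j ≥ 0`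

Vanishing : (ℕ → ℤ → ℤ) → Set
Vanishing t = ∀ j i → t j -[1+ i ] ≡ 0ℤ

vanish : ∀ t → Vanishing t → ∀ j {m} → m < 0ℤ → t j m ≡ 0ℤ
vanish t v j { -[1+ i ]} _        = v j i
vanish t v j {+ _}       (+<+ ())

-- The sum over all j ≥ 0 of t j (k - d j), for t j vanishing on negative
-- arguments; the terms with j > ∣ k ∣ are zero.
∑ : ℕ → (ℕ → ℤ → ℤ) → ℤ → ℤ
∑ d t k = sumTo ∣ k ∣ (λ j → t j (k - + d * + j))

module _ (d : ℕ) .{{_ : NonZero d}} where

  negative : ∀ B {k} → k < + (d ℕ.* suc B) → ∀ j → B ℕ.< j → k - + d * + j < 0ℤ
  negative B {k} k< j B<j = subst (k - x <_) (ℤ.+-inverseʳ x) (ℤ.+-monoˡ-< (- x) (ℤ.<-≤-trans k<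
    (subst (+ (d ℕ.* suc B) ≤_) (ℤ.pos-* d j) (+≤+ (ℕ.*-monoʳ-≤ d B<j)))))
    where x = + d * + j

  k<d[1+∣k∣] : ∀ k → k < + (d ℕ.* suc ∣ k ∣)
  k<d[1+∣k∣] (+ k)    = +<+ (ℕ.m≤n*m (suc k) d)
  k<d[1+∣k∣] -[1+ _ ] = -<+

  -- From `j = B + 1` on, `k - d j` is negative and the terms vanish, so `B` may replace `∣ k ∣`.
  ∑-bound : ∀ t → Vanishing t → ∀ B k → k < + (d ℕ.* suc B) →
            sumTo B (λ j → t j (k - + d * + j)) ≡ ∑ d t k
  ∑-bound t v B k k< = sumTo-bound B ∣ k ∣ _
    (λ j B<j → vanish t v j (negative B k< j B<j))
    (λ j k<j → vanish t v j (negative ∣ k ∣ (k<d[1+∣k∣] k) j k<j))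

  ∑-negative : ∀ t → Vanishing t → ∀ i → ∑ d t -[1+ i ] ≡ 0ℤ
  ∑-negative t v i = sumTo-0 (suc i) λ j → vanish t v j
    (ℤ.≤-<-trans (ℤ.i-j≤i -[1+ i ] (+ d * + j) {{subst NonNegative (ℤ.pos-* d j) _}}) -<+)

  ∑-cong : ∀ {t u} → (∀ j m → t j m ≡ u j m) → ∀ k → ∑ d t k ≡ ∑ d u k
  ∑-cong t≡u k = sumTo-cong ∣ k ∣ λ j → t≡u j _

  ∑-+ : ∀ t u k → ∑ d (λ j m → t j m + u j m) k ≡ ∑ d t k + ∑ d u k
  ∑-+ t u k = sumTo-+ ∣ k ∣ (λ j → t j (k - + d * + j)) (λ j → u j (k - + d * + j))

  below : ∀ k {i} .{{_ : NonNegative i}} → k - i < + (d ℕ.* suc ∣ k ∣)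
  below k {i} = ℤ.≤-<-trans (ℤ.i-j≤i k i) (k<d[1+∣k∣] k)

  ∑-shift : ∀ t → Vanishing t → ∀ k → ∑ d (λ j m → t j (m - 1ℤ)) k ≡ ∑ d t (k - 1ℤ)
  ∑-shift t v k = trans (sumTo-cong ∣ k ∣ λ j → cong (t j) (rearrange k (+ d * + j)))
    (∑-bound t v ∣ k ∣ (k - 1ℤ) (below k))
    where
    rearrange : ∀ k x → k - x - 1ℤ ≡ k - 1ℤ - x
    rearrange = solve-∀

  -- A series in `zᵈ` is its first term plus `zᵈ` times the series with indices moved by one. The
  -- recurrences in `N` and the base case start here.
  ∑-suc : ∀ t → Vanishing t → ∀ k → ∑ d t k ≡ t 0 k + ∑ d (t ∘ suc) (k - + d)
  ∑-suc t v k = begin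
    ∑ d t k
      -- The limit is raised to `∣ k ∣ + 1` so that `∣ k ∣` is left once `j = 0` is removed.
      ≡⟨ ∑-bound t v (suc B) k (ℤ.<-≤-trans (k<d[1+∣k∣] k) (+≤+ (ℕ.*-monoʳ-≤ d (ℕ.n≤1+n (suc B))))) ⟨
    sumTo (suc B) (λ j → t j (k - + d * + j))
      ≡⟨ sumTo-suc B (λ j → t j (k - + d * + j)) ⟩
    t 0 (k - + d * 0ℤ) + sumTo B (λ j → t (suc j) (k - + d * + suc j))
      ≡⟨ cong₂ _+_ (cong (t 0) (k-d*0≡k k (+ d))) (sumTo-cong B λ j → cong (t (suc j)) (peel k (+ d) (+ j))) ⟩
    t 0 k + sumTo B (λ j → t (suc j) (k - + d - + d * + j))
      ≡⟨ cong (λ x → t 0 k + x) (∑-bound (t ∘ suc) (v ∘ suc) B (k - + d) (below k)) ⟩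
    t 0 k + ∑ d (t ∘ suc) (k - + d) ∎
    where
    B = ∣ k ∣
    k-d*0≡k : ∀ k d → k - d * 0ℤ ≡ k
    k-d*0≡k = solve-∀
    peel : ∀ k d j → k - d * (1ℤ + j) ≡ k - d - d * j
    peel = solve-∀

-- Recurrences of both sides in `N` and `L`

binom₂-+suc : ∀ t → binom₂ (+ suc t) ≡ + (suc t ℕ.* t / 2)
binom₂-+suc t = cong (λ x → x /ℕ 2) (sym (ℤ.pos-* (suc t) t))

binom₂-suc : ∀ t → binom₂ (+ suc t) ≡ binom₂ (+ t) + + t
binom₂-suc zero    = refl
binom₂-suc (suc t) = begin
  binom₂ (+ suc (suc t))                       ≡⟨ binom₂-+suc (suc t) ⟩
  -- Natural division distributes over this sum because the second summand is even.
  + (suc (suc t) ℕ.* suc t / 2)                ≡⟨ cong (λ x → + (x / 2)) (split t) ⟩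
  + ((suc t ℕ.* t ℕ.+ suc t ℕ.* 2) / 2)        ≡⟨ cong +_ (+-distrib-/-∣ʳ (suc t ℕ.* t) (n∣m*n (suc t))) ⟩
  + (suc t ℕ.* t / 2) + + (suc t ℕ.* 2 / 2)    ≡⟨ cong₂ _+_ (sym (binom₂-+suc t)) (cong +_ (m*n/n≡m (suc t) 2)) ⟩
  binom₂ (+ suc t) + + suc t                   ∎
  where
  split : ∀ t → suc (suc t) ℕ.* suc t ≡ suc t ℕ.* t ℕ.+ suc t ℕ.* 2
  split = ℕ.solve-∀

-- ∑ 4 (leftTerm N L n) k is the coefficient of zᵏqⁿ in
-- ∏_{i<L} (1 + z qⁱ) / ∏_{i≤N} (1 - z⁴ q⁴ⁱ).
leftTerm : (N L : ℕ) (n : ℤ) → ℕ → ℤ → ℤ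
leftTerm N L n j m = + p̄ 4 (+ N) (+ L - m) (+ j) m (n - binom₂ m)

-- ∑ 2 (rightTerm N L n) k is the coefficient of zᵏqⁿ in
-- 1 / (∏_{i≤L} (1 - z qⁱ) ∏_{i≤N} (1 + z² q²ⁱ)).
rightTerm : (N L : ℕ) (n : ℤ) → ℕ → ℤ → ℤ
rightTerm N L n j m = -1ℤ ^ j * + p̄ 2 (+ N) (+ L) (+ j) m n

leftTerm-vanishing : ∀ N L n → Vanishing (leftTerm N L n)
leftTerm-vanishing N L n j i = cong +_ (p̄-negativeParts₂ 4 (+ N) (+ L - -[1+ i ]) (+ j) i (n - binom₂ -[1+ i ]))

rightTerm-vanishing : ∀ N L n → Vanishing (rightTerm N L n)
rightTerm-vanishing N L n j i = trans
  (cong (λ p → -1ℤ ^ j * + p) (p̄-negativeParts₂ 2 (+ N) (+ L) (+ j) i n)) (ℤ.*-zeroʳ (-1ℤ ^ j))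

left right : (N L : ℕ) (k n : ℤ) → ℤ
left  N L k n = ∑ 4 (leftTerm N L n) k
right N L k n = ∑ 2 (rightTerm N L n) k

-- Extends `p̄-split₂` to bounds `d ≤ 0`, which `L - m` can reach. With 0 for `suc t` it would fail
-- at `d = 0`, where the left side can be 1 and the right side is 0.
p̄-pascal : ∀ r .{{_ : NonZero r}} N₁ d k₁ t n →
           p̄ r N₁ d k₁ (+ suc t) n ≡ p̄ r N₁ (d - 1ℤ) k₁ (+ suc t) n ℕ.+ p̄ r N₁ d k₁ (+ t) (n - d)
p̄-pascal r N₁ (+ suc d) k₁ t n = p̄-split₂ r N₁ d k₁ (+ suc t) n
p̄-pascal r N₁ (+ zero) k₁ t n = begin
  p̄ r N₁ 0ℤ k₁ (+ suc t) n      ≡⟨ p̄-emptyOnly₂ r N₁ 0 k₁ (suc t) n 0 t (inj₁ refl) (inj₁ refl) ⟩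
  p̄ r N₁ 0ℤ k₁ (+ t) n          ≡⟨ cong (p̄ r N₁ 0ℤ k₁ (+ t)) (ℤ.+-identityʳ n) ⟨
  p̄ r N₁ 0ℤ k₁ (+ t) (n - 0ℤ)   ≡⟨ cong (ℕ._+ p̄ r N₁ 0ℤ k₁ (+ t) (n - 0ℤ))
                                       (p̄-negativeBound₂ r N₁ 0 k₁ (+ suc t) n) ⟨
  p̄ r N₁ -1ℤ k₁ (+ suc t) n ℕ.+ p̄ r N₁ 0ℤ k₁ (+ t) (n - 0ℤ) ∎
p̄-pascal r N₁ -[1+ i ] k₁ t n = trans (p̄-negativeBound₂ r N₁ i k₁ (+ suc t) n) (sym (cong₂ ℕ._+_
  (p̄-negativeBound₂ r N₁ (suc (i ℕ.+ 0)) k₁ (+ suc t) n) (p̄-negativeBound₂ r N₁ i k₁ (+ t) (n - -[1+ i ]))))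

-- The factor `1 + z qᴸ`. Subtracting the staircase `m - 1, …, 0` from `m` distinct numbers below
-- `L` leaves at most `m` parts of size at most `L - m` and accounts for `binom₂ m`. The summands
-- say whether the new number `L` is absent or present.
leftTerm-sucᴸ : ∀ N L n j m → leftTerm N (suc L) n j m ≡ leftTerm N L n j m + leftTerm N L (n - + L) j (m - 1ℤ)
leftTerm-sucᴸ N L n j -[1+ i ] = trans (leftTerm-vanishing N (suc L) n j i) (sym (cong₂ _+_
  (leftTerm-vanishing N L n j i) (leftTerm-vanishing N L (n - + L) j (suc (i ℕ.+ 0)))))
-- For `m = 0` no part of the second kind can occur, so raising the bound changes nothing.
leftTerm-sucᴸ N L n j (+ zero) = begin
  + p̄ 4 (+ N) (+ suc L + 0ℤ) (+ j) 0ℤ (n - 0ℤ)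
    ≡⟨ cong +_ (p̄-emptyOnly₂ 4 (+ N) (suc L ℕ.+ 0) (+ j) 0 (n - 0ℤ) (L ℕ.+ 0) 0 (inj₂ refl) (inj₂ refl)) ⟩
  leftTerm N L n j 0ℤ
    ≡⟨ ℤ.+-identityʳ _ ⟨
  leftTerm N L n j 0ℤ + 0ℤ
    ≡⟨ cong (λ x → leftTerm N L n j 0ℤ + x) (leftTerm-vanishing N L (n - + L) j 0) ⟨
  leftTerm N L n j 0ℤ + leftTerm N L (n - + L) j -1ℤ ∎
leftTerm-sucᴸ N L n j (+ suc t) = begin
  + p̄ 4 (+ N) (+ suc L - + suc t) (+ j) (+ suc t) ν
    ≡⟨ cong (λ d → + p̄ 4 (+ N) d (+ j) (+ suc t) ν) (e₁ (+ L) (+ t)) ⟩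
  + p̄ 4 (+ N) (+ L - + t) (+ j) (+ suc t) ν
    ≡⟨ cong +_ (p̄-pascal 4 (+ N) (+ L - + t) (+ j) t ν) ⟩
  + p̄ 4 (+ N) (+ L - + t - 1ℤ) (+ j) (+ suc t) ν + + p̄ 4 (+ N) (+ L - + t) (+ j) (+ t) (ν - (+ L - + t))
    ≡⟨ cong₂ (λ d n′ → + p̄ 4 (+ N) d (+ j) (+ suc t) ν + + p̄ 4 (+ N) (+ L - + t) (+ j) (+ t) n′)
         (e₂ (+ L) (+ t))
         -- The removed part `L - t` and the staircase step `t` add up to `L`.
         (trans (cong (λ b → n - b - (+ L - + t)) (binom₂-suc t)) (e₃ n (binom₂ (+ t)) (+ L) (+ t))) ⟩
  leftTerm N L n j (+ suc t) + leftTerm N L (n - + L) j (+ t) ∎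
  where
  ν = n - binom₂ (+ suc t)
  e₁ : ∀ L t → 1ℤ + L - (1ℤ + t) ≡ L - t
  e₁ = solve-∀
  e₂ : ∀ L t → L - t - 1ℤ ≡ L - (1ℤ + t)
  e₂ = solve-∀
  e₃ : ∀ n b L t → n - (b + t) - (L - t) ≡ n - L - b
  e₃ = solve-∀

left-sucᴸ : ∀ N L k n → left N (suc L) k n ≡ left N L k n + left N L (k - 1ℤ) (n - + L)
left-sucᴸ N L k n = begin
  left N (suc L) k n
    ≡⟨ ∑-cong 4 (leftTerm-sucᴸ N L n) k ⟩
  ∑ 4 (λ j m → leftTerm N L n j m + leftTerm N L (n - + L) j (m - 1ℤ)) k
    ≡⟨ ∑-+ 4 (leftTerm N L n) (λ j m → leftTerm N L (n - + L) j (m - 1ℤ)) k ⟩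
  left N L k n + ∑ 4 (λ j m → leftTerm N L (n - + L) j (m - 1ℤ)) k
    ≡⟨ cong (λ x → left N L k n + x) (∑-shift 4 (leftTerm N L (n - + L))
         (leftTerm-vanishing N L (n - + L)) k) ⟩
  left N L k n + left N L (k - 1ℤ) (n - + L) ∎

-- Division by `1 - z⁴ q^(4(N + 1))`: removing a largest part of the first kind takes `j + 1` to
-- `j`, and the term `j = 0` has no such part.
left-sucᴺ : ∀ N L k n → left (suc N) L k n ≡ left N L k n + left (suc N) L (k - + 4) (n - + (suc N ℕ.* 4))
left-sucᴺ N L k n = begin
  left (suc N) L k n
    ≡⟨ ∑-suc 4 (leftTerm (suc N) L n) (leftTerm-vanishing (suc N) L n) k ⟩
  leftTerm (suc N) L n 0 k + ∑ 4 (λ j → leftTerm (suc N) L n (suc j)) (k - + 4)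
    ≡⟨ cong₂ _+_ (cong +_ (p̄-emptyOnly₁ 4 4 (suc N) (+ L - k) 0 k (n - binom₂ k) N 0 (inj₂ refl) (inj₂ refl)))
         (trans (∑-cong 4 step (k - + 4))
           (∑-+ 4 (λ j → leftTerm N L n (suc j)) (leftTerm (suc N) L (n - s)) (k - + 4))) ⟩
  leftTerm N L n 0 k + (∑ 4 (λ j → leftTerm N L n (suc j)) (k - + 4) + left (suc N) L (k - + 4) (n - s))
    ≡⟨ ℤ.+-assoc (leftTerm N L n 0 k) (∑ 4 (λ j → leftTerm N L n (suc j)) (k - + 4))
         (left (suc N) L (k - + 4) (n - s)) ⟨
  leftTerm N L n 0 k + ∑ 4 (λ j → leftTerm N L n (suc j)) (k - + 4) + left (suc N) L (k - + 4) (n - s)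
    ≡⟨ cong (λ x → x + left (suc N) L (k - + 4) (n - s))
         (∑-suc 4 (leftTerm N L n) (leftTerm-vanishing N L n) k) ⟨
  left N L k n + left (suc N) L (k - + 4) (n - s) ∎
  where
  s = + (suc N ℕ.* 4)
  swap- : ∀ n b s → n - b - s ≡ n - s - b
  swap- = solve-∀
  step : ∀ j m → leftTerm (suc N) L n (suc j) m ≡ leftTerm N L n (suc j) m + leftTerm (suc N) L (n - s) j m
  step j m = trans (cong +_ (p̄-split₁ 4 N (+ L - m) (+ suc j) m (n - binom₂ m)))
    (cong (λ n′ → leftTerm N L n (suc j) m + + p̄ 4 (+ suc N) (+ L - m) (+ j) m n′) (swap- n (binom₂ m) s))

-- Division by `1 - z q^(L + 1)`: parts may repeat, so the last summand keeps `suc L`, unlike in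
-- `left-sucᴸ`.
right-sucᴸ : ∀ N L k n → right N (suc L) k n ≡ right N L k n + right N (suc L) (k - 1ℤ) (n - + suc L)
right-sucᴸ N L k n = begin
  right N (suc L) k n
    ≡⟨ ∑-cong 2 step k ⟩
  ∑ 2 (λ j m → rightTerm N L n j m + rightTerm N (suc L) (n - + suc L) j (m - 1ℤ)) k
    ≡⟨ ∑-+ 2 (rightTerm N L n) (λ j m → rightTerm N (suc L) (n - + suc L) j (m - 1ℤ)) k ⟩
  right N L k n + ∑ 2 (λ j m → rightTerm N (suc L) (n - + suc L) j (m - 1ℤ)) k
    ≡⟨ cong (λ x → right N L k n + x) (∑-shift 2 (rightTerm N (suc L) (n - + suc L))
         (rightTerm-vanishing N (suc L) (n - + suc L)) k) ⟩
  right N L k n + right N (suc L) (k - 1ℤ) (n - + suc L) ∎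
  where
  step : ∀ j m → rightTerm N (suc L) n j m ≡ rightTerm N L n j m + rightTerm N (suc L) (n - + suc L) j (m - 1ℤ)
  step j m = trans (cong (λ p → -1ℤ ^ j * + p) (p̄-split₂ 2 (+ N) L (+ j) m n)) (ℤ.*-distribˡ-+ (-1ℤ ^ j) _ _)

-- Division by `1 + z² q^(2(N + 1))`: removing a part lowers `j` and flips the sign `-1ℤ ^ j`, so
-- the second sum stands on the left.
right-sucᴺ : ∀ N L k n → right (suc N) L k n + right (suc N) L (k - + 2) (n - + (suc N ℕ.* 2)) ≡ right N L k n
right-sucᴺ N L k n = begin
  right (suc N) L k n + right (suc N) L (k - + 2) (n - s)
    ≡⟨ cong (λ x → x + right (suc N) L (k - + 2) (n - s))
         (∑-suc 2 (rightTerm (suc N) L n) (rightTerm-vanishing (suc N) L n) k) ⟩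
  rightTerm (suc N) L n 0 k + ∑ 2 (λ j → rightTerm (suc N) L n (suc j)) (k - + 2) + right (suc N) L (k - + 2) (n - s)
    ≡⟨ ℤ.+-assoc (rightTerm (suc N) L n 0 k) _ _ ⟩
  rightTerm (suc N) L n 0 k + (∑ 2 (λ j → rightTerm (suc N) L n (suc j)) (k - + 2) + right (suc N) L (k - + 2) (n - s))
    ≡⟨ cong₂ _+_ (cong (λ p → 1ℤ * + p) (p̄-emptyOnly₁ 2 2 (suc N) (+ L) 0 k n N 0 (inj₂ refl) (inj₂ refl)))
         (trans (sym (∑-+ 2 (λ j → rightTerm (suc N) L n (suc j)) (rightTerm (suc N) L (n - s)) (k - + 2)))
           (∑-cong 2 step (k - + 2))) ⟩
  rightTerm N L n 0 k + ∑ 2 (λ j → rightTerm N L n (suc j)) (k - + 2)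
    ≡⟨ ∑-suc 2 (rightTerm N L n) (rightTerm-vanishing N L n) k ⟨
  right N L k n ∎
  where
  s = + (suc N ℕ.* 2)
  cancel : ∀ x p q → -1ℤ * x * (p + q) + x * q ≡ -1ℤ * x * p
  cancel = solve-∀
  step : ∀ j m → rightTerm (suc N) L n (suc j) m + rightTerm (suc N) L (n - s) j m ≡ rightTerm N L n (suc j) m
  step j m = trans (cong (λ p → -1ℤ ^ suc j * + p + rightTerm (suc N) L (n - s) j m) (p̄-split₁ 2 N (+ L) (+ suc j) m n))
    (cancel (-1ℤ ^ j) (+ p̄ 2 (+ N) (+ L) (+ suc j) m n) (+ p̄ 2 (+ suc N) (+ L) (+ j) m (n - s)))

left-negative : ∀ N L i n → left N L -[1+ i ] n ≡ 0ℤ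
left-negative N L i n = ∑-negative 4 (leftTerm N L n) (leftTerm-vanishing N L n) i

right-negative : ∀ N L i n → right N L -[1+ i ] n ≡ 0ℤ
right-negative N L i n = ∑-negative 2 (rightTerm N L n) (rightTerm-vanishing N L n) i

-- The case `N = 0`

-- The factor `i = 0` of the denominator is `1 - z⁴`; it reflects that `j` is an upper bound for the
-- number of parts, so every `j` contributes the empty partition.
left₀-rec : ∀ k n → left 0 1 k n ≡ leftTerm 0 1 n 0 k + left 0 1 (k - + 4) n
left₀-rec k n = trans (∑-suc 4 (leftTerm 0 1 n) (leftTerm-vanishing 0 1 n) k)
  (cong (λ x → leftTerm 0 1 n 0 k + x) (∑-cong 4 (λ j m →
    cong +_ (p̄-emptyOnly₁ 4 4 0 (1ℤ - m) (suc j) m (n - binom₂ m) 0 j (inj₁ refl) (inj₁ refl))) (k - + 4)))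

-- Multiplication by `1 + z²`: consecutive terms cancel by sign, and only `j = 0` survives.
right₀-rec : ∀ k n → right 0 0 k n + right 0 0 (k - + 2) n ≡ rightTerm 0 0 n 0 k
right₀-rec k n = begin
  right 0 0 k n + right 0 0 (k - + 2) n
    ≡⟨ cong (λ x → x + right 0 0 (k - + 2) n) (∑-suc 2 (rightTerm 0 0 n) (rightTerm-vanishing 0 0 n) k) ⟩
  rightTerm 0 0 n 0 k + ∑ 2 (λ j → rightTerm 0 0 n (suc j)) (k - + 2) + right 0 0 (k - + 2) n
    ≡⟨ ℤ.+-assoc (rightTerm 0 0 n 0 k) _ _ ⟩
  rightTerm 0 0 n 0 k + (∑ 2 (λ j → rightTerm 0 0 n (suc j)) (k - + 2) + right 0 0 (k - + 2) n)
    ≡⟨ cong (λ x → rightTerm 0 0 n 0 k + x) (trans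
         (sym (∑-+ 2 (λ j → rightTerm 0 0 n (suc j)) (rightTerm 0 0 n) (k - + 2)))
         (sumTo-0 ∣ k - + 2 ∣ (λ j → step j (k - + 2 - + 2 * + j)))) ⟩
  rightTerm 0 0 n 0 k + 0ℤ
    ≡⟨ ℤ.+-identityʳ _ ⟩
  rightTerm 0 0 n 0 k ∎
  where
  cancel : ∀ x p → -1ℤ * x * p + x * p ≡ 0ℤ
  cancel = solve-∀
  step : ∀ j m → rightTerm 0 0 n (suc j) m + rightTerm 0 0 n j m ≡ 0ℤ
  step j m = trans (cong (λ p → -1ℤ ^ suc j * + p + rightTerm 0 0 n j m)
    (p̄-emptyOnly₁ 2 2 0 0ℤ (suc j) m n 0 j (inj₁ refl) (inj₁ refl))) (cancel (-1ℤ ^ j) (+ p̄ 2 0ℤ 0ℤ (+ j) m n))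

k-2-2≡k-4 : ∀ k → k - + 2 - + 2 ≡ k - + 4
k-2-2≡k-4 = solve-∀

-- For N = 0 the terms with j = 0 are the coefficients of 1 + z on the left and
-- of 1 / (1 - z) on the right.
firstTerms : ∀ k n → leftTerm 0 1 n 0 k + rightTerm 0 0 n 0 (k - + 2) ≡ rightTerm 0 0 n 0 k
firstTerms -[1+ i ] n = trans
  (cong₂ _+_ (leftTerm-vanishing 0 1 n 0 i) (rightTerm-vanishing 0 0 n 0 (suc (i ℕ.+ 1))))
  (sym (rightTerm-vanishing 0 0 n 0 i))
firstTerms (+ 0) n = begin
  + p̄ 4 0ℤ 1ℤ 0ℤ 0ℤ (n - 0ℤ) + rightTerm 0 0 n 0 -[1+ 1 ]
    ≡⟨ cong (λ x → + p̄ 4 0ℤ 1ℤ 0ℤ 0ℤ (n - 0ℤ) + x) (rightTerm-vanishing 0 0 n 0 1) ⟩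
  + p̄ 4 0ℤ 1ℤ 0ℤ 0ℤ (n - 0ℤ) + 0ℤ
    ≡⟨ ℤ.+-identityʳ _ ⟩
  + p̄ 4 0ℤ 1ℤ 0ℤ 0ℤ (n - 0ℤ)
    ≡⟨ cong (λ n → + p̄ 4 0ℤ 1ℤ 0ℤ 0ℤ n) (ℤ.+-identityʳ n) ⟩
  + p̄ 4 0ℤ 1ℤ 0ℤ 0ℤ n
    ≡⟨ cong +_ (trans (p̄-emptyOnly₁ 4 2 0 1ℤ 0 0ℤ n 0 0 (inj₁ refl) (inj₁ refl))
                      (p̄-emptyOnly₂ 2 0ℤ 1 0ℤ 0 n 0 0 (inj₂ refl) (inj₁ refl))) ⟩
  + p̄ 2 0ℤ 0ℤ 0ℤ 0ℤ n
    ≡⟨ ℤ.*-identityˡ _ ⟨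
  rightTerm 0 0 n 0 0ℤ ∎
firstTerms (+ 1) n = begin
  + p̄ 4 0ℤ 0ℤ 0ℤ 1ℤ (n - 0ℤ) + rightTerm 0 0 n 0 -[1+ 0 ]
    ≡⟨ cong (λ x → + p̄ 4 0ℤ 0ℤ 0ℤ 1ℤ (n - 0ℤ) + x) (rightTerm-vanishing 0 0 n 0 0) ⟩
  + p̄ 4 0ℤ 0ℤ 0ℤ 1ℤ (n - 0ℤ) + 0ℤ
    ≡⟨ ℤ.+-identityʳ _ ⟩
  + p̄ 4 0ℤ 0ℤ 0ℤ 1ℤ (n - 0ℤ)
    ≡⟨ cong (λ n → + p̄ 4 0ℤ 0ℤ 0ℤ 1ℤ n) (ℤ.+-identityʳ n) ⟩
  + p̄ 4 0ℤ 0ℤ 0ℤ 1ℤ n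
    ≡⟨ cong +_ (p̄-emptyOnly₁ 4 2 0 0ℤ 0 1ℤ n 0 0 (inj₁ refl) (inj₁ refl)) ⟩
  + p̄ 2 0ℤ 0ℤ 0ℤ 1ℤ n
    ≡⟨ ℤ.*-identityˡ _ ⟨
  rightTerm 0 0 n 0 1ℤ ∎
firstTerms (+ suc (suc k)) n = begin
  leftTerm 0 1 n 0 (+ suc (suc k)) + rightTerm 0 0 n 0 (+ k)
    ≡⟨ cong (λ p → + p + rightTerm 0 0 n 0 (+ k))
         (p̄-negativeBound₂ 4 0ℤ k 0ℤ (+ suc (suc k)) (n - binom₂ (+ suc (suc k)))) ⟩
  0ℤ + rightTerm 0 0 n 0 (+ k)
    ≡⟨ ℤ.+-identityˡ _ ⟩
  rightTerm 0 0 n 0 (+ k)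
    ≡⟨ cong (λ p → 1ℤ * + p) (p̄-emptyOnly₂ 2 0ℤ 0 0ℤ k n 0 (suc (suc k)) (inj₁ refl) (inj₁ refl)) ⟩
  rightTerm 0 0 n 0 (+ suc (suc k)) ∎

-- With `R = 1 / ((1 - z)(1 + z²))`, `firstTerms` yields `R + z² R = 1 + z + z² R + z⁴ R`, and
-- `z² R` is cancelled.
right₀-left-rec : ∀ k n → right 0 0 k n ≡ leftTerm 0 1 n 0 k + right 0 0 (k - + 4) n
right₀-left-rec k n = ∙-cancelʳ ℤ.+-0-abelianGroup (right 0 0 (k - + 2) n) _ _ (begin
  right 0 0 k n + right 0 0 (k - + 2) n       ≡⟨ right₀-rec k n ⟩
  rightTerm 0 0 n 0 k                        ≡⟨ firstTerms k n ⟨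
  leftTerm 0 1 n 0 k + rightTerm 0 0 n 0 (k - + 2)
    ≡⟨ cong (λ x → leftTerm 0 1 n 0 k + x)
         (trans (sym (right₀-rec (k - + 2) n)) (cong (λ k′ → right 0 0 (k - + 2) n + right 0 0 k′ n) (k-2-2≡k-4 k))) ⟩
  leftTerm 0 1 n 0 k + (right 0 0 (k - + 2) n + right 0 0 (k - + 4) n)
    ≡⟨ rearrange (leftTerm 0 1 n 0 k) (right 0 0 (k - + 2) n) (right 0 0 (k - + 4) n) ⟩
  leftTerm 0 1 n 0 k + right 0 0 (k - + 4) n + right 0 0 (k - + 2) n ∎)
  where
  rearrange : ∀ x y z → x + (y + z) ≡ x + z + y
  rearrange = solve-∀

-- The step from `N` to `N + 1`

-- `N` and `L` rise together, so that the whole factor for `i = N + 1` enters at once.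
left-rec : ∀ N k n → left (suc N) (suc (suc N)) k n ≡
           left N (suc N) k n + left N (suc N) (k - 1ℤ) (n - + suc N) +
           left (suc N) (suc (suc N)) (k - + 4) (n - + (suc N ℕ.* 4))
left-rec N k n = trans (left-sucᴺ N (suc (suc N)) k n)
  (cong (λ x → x + left (suc N) (suc (suc N)) (k - + 4) (n - + (suc N ℕ.* 4))) (left-sucᴸ N (suc N) k n))

-- (1 + z qᵃ)(1 - z qᵃ)(1 + z² q²ᵃ) = 1 - z⁴ q⁴ᵃ with a = N + 1.
right-rec : ∀ N k n → right (suc N) (suc N) k n ≡
            right N N k n + right N N (k - 1ℤ) (n - + suc N) +
            right (suc N) (suc N) (k - + 4) (n - + (suc N ℕ.* 4))
right-rec N k n = combine _ _ (g k n) (h k n) (h k₁ n₁) (g k₁ n₁) (h k₂ n₂) (g′ k₂ n₂)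
  (right-sucᴺ N (suc N) k n) (right-sucᴸ N N k n)
  (trans (right-sucᴸ N N k₁ n₁) (cong₂ (λ k n → g k₁ n₁ + h k n) (k-1-1 k) (n-a-a n N)))
  (trans (cong₂ (λ k n → g′ k₂ n₂ + g′ k n) (sym (k-2-2≡k-4 k)) (n-2a-2a n N)) (right-sucᴺ N (suc N) k₂ n₂))
  where
  g  = right N N
  h  = right N (suc N)
  g′ = right (suc N) (suc N)
  k₁ = k - 1ℤ
  k₂ = k - + 2
  n₁ = n - + suc N
  n₂ = n - + (suc N ℕ.* 2)
  k-1-1 : ∀ k → k - 1ℤ - 1ℤ ≡ k - + 2
  k-1-1 = solve-∀
  n-a-a : ∀ n N → n - + suc N - + suc N ≡ n - + (suc N ℕ.* 2)
  n-a-a n N = trans (lem n (+ suc N)) (cong (λ x → n - x) (sym (ℤ.pos-* (suc N) 2)))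
    where
    lem : ∀ n a → n - a - a ≡ n - a * + 2
    lem = solve-∀
  n-2a-2a : ∀ n N → n - + (suc N ℕ.* 4) ≡ n - + (suc N ℕ.* 2) - + (suc N ℕ.* 2)
  n-2a-2a n N = trans (cong (λ x → n - x) (ℤ.pos-* (suc N) 4))
    (trans (lem n (+ suc N)) (cong (λ x → n - x - x) (sym (ℤ.pos-* (suc N) 2))))
    where
    lem : ∀ n a → n - a * + 4 ≡ n - a * + 2 - a * + 2
    lem = solve-∀
  -- `g` belongs to the old product, `h` to its quotient by `1 - z qᵃ`, and `g′` to the further
  -- quotient by `1 + z² q²ᵃ`; indices are shifts of `k`. Eliminating the `h` terms leaves `g′₂` on
  -- both sides.
  combine : ∀ g′₀ g′₄ g₀ h₀ h₁ g₁ h₂ g′₂ → g′₀ + g′₂ ≡ h₀ → h₀ ≡ g₀ + h₁ → h₁ ≡ g₁ + h₂ → g′₂ + g′₄ ≡ h₂ →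
            g′₀ ≡ g₀ + g₁ + g′₄
  combine g′₀ g′₄ g₀ _ _ g₁ _ g′₂ a b refl refl =
    ∙-cancelʳ ℤ.+-0-abelianGroup g′₂ _ _ (trans a (trans b (lem g₀ g₁ g′₂ g′₄)))
    where
    lem : ∀ g₀ g₁ g′₂ g′₄ → g₀ + (g₁ + (g′₂ + g′₄)) ≡ g₀ + g₁ + g′₄ + g′₂
    lem = solve-∀

-- Uniqueness and conclusion

-- Induction on a bound for `k`, which drops by 4 until it is negative; `n` stays general because it
-- moves by `s`.
recurrence-unique : ∀ (s : ℤ) (f g b : ℤ → ℤ → ℤ) →
  (∀ i n → f -[1+ i ] n ≡ 0ℤ) → (∀ i n → g -[1+ i ] n ≡ 0ℤ) →
  (∀ k n → f k n ≡ b k n + f (k - + 4) (n - s)) → (∀ k n → g k n ≡ b k n + g (k - + 4) (n - s)) →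
  ∀ k n → f k n ≡ g k n
recurrence-unique s f g b f₋ g₋ f-rec g-rec k = go (suc ∣ k ∣) k (k<1+∣k∣ k)
  where
  k<1+∣k∣ : ∀ k → k < + suc ∣ k ∣
  k<1+∣k∣ (+ k)    = +<+ ℕ.≤-refl
  k<1+∣k∣ -[1+ _ ] = -<+
  go : ∀ B k → k < + B → ∀ n → f k n ≡ g k n
  go B       -[1+ i ] _  n = trans (f₋ i n) (sym (g₋ i n))
  go zero    (+ _) (+<+ ()) n
  go (suc B) (+ k) (+<+ (s≤s k≤B)) n = begin
    f (+ k) n                                  ≡⟨ f-rec (+ k) n ⟩
    b (+ k) n + f (+ k - + 4) (n - s)          ≡⟨ cong (λ x → b (+ k) n + x) (go B (+ k - + 4) k-4<B (n - s)) ⟩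
    b (+ k) n + g (+ k - + 4) (n - s)          ≡⟨ g-rec (+ k) n ⟨
    g (+ k) n                                  ∎
    where
    k-4<B : + k - + 4 < + B
    k-4<B = ℤ.<-≤-trans
      (subst (+ k - + 4 <_) (ℤ.+-identityʳ (+ k)) (ℤ.+-monoʳ-< (+ k) { -[1+ 3 ]} {0ℤ} -<+)) (+≤+ k≤B)

-- Induction on `N`: both sides solve one recurrence whose inhomogeneous term comes from the
-- previous stage. The left product runs over `i < L`, hence `L = suc N`.
left≡right : ∀ N k n → left N (suc N) k n ≡ right N N k n
-- The denominator `1 - z⁴` contains no `q`, so the shift of `n` is 0.
left≡right zero = recurrence-unique 0ℤ (left 0 1) (right 0 0) (λ k n → leftTerm 0 1 n 0 k)
  (left-negative 0 1) (right-negative 0 0)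
  (λ k n → trans (left₀-rec k n) (cong (λ n′ → leftTerm 0 1 n 0 k + left 0 1 (k - + 4) n′) (sym (ℤ.+-identityʳ n))))
  (λ k n → trans (right₀-left-rec k n) (cong (λ n′ → leftTerm 0 1 n 0 k + right 0 0 (k - + 4) n′) (sym (ℤ.+-identityʳ n))))
left≡right (suc N) = recurrence-unique (+ (suc N ℕ.* 4)) (left (suc N) (suc (suc N))) (right (suc N) (suc N))
  (λ k n → right N N k n + right N N (k - 1ℤ) (n - + suc N))
  (left-negative (suc N) (suc (suc N))) (right-negative (suc N) (suc N))
  (λ k n → trans (left-rec N k n) (cong (λ x → x + left (suc N) (suc (suc N)) (k - + 4) (n - + (suc N ℕ.* 4)))
     (cong₂ _+_ (left≡right N k n) (left≡right N (k - 1ℤ) (n - + suc N)))))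
  (right-rec N)

-- Makes the quotient an admissible limit in `∑-bound`.
k<d[1+k/d] : ∀ k d .{{_ : NonZero d}} → + k < + (d ℕ.* suc (k / d))
k<d[1+k/d] k d = +<+ (subst₂ ℕ._<_ (sym (m≡m%n+[m/n]*n k d)) (ℕ.*-comm (suc (k / d)) d)
  (ℕ.+-monoˡ-< (k / d ℕ.* d) (m%n<n k d)))

theorem3p3 : (N k n : ℕ) →
    (Σ[ j ≤ k / 4 ] (+ p̄ 4 (+ N) (+ N + 1ℤ - + k + + 4 * + j) (+ j) (+ k - + 4 * + j) (+ n - binom₂ (+ k - + 4 * + j))))
    ≡ (Σ[ j ≤ k / 2 ] (-1ℤ ^ j * + p̄ 2 (+ N) (+ N) (+ j) (+ k - + 2 * + j) (+ n)))
theorem3p3 N k n = begin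
  (Σ[ j ≤ k / 4 ] (+ p̄ 4 (+ N) (+ N + 1ℤ - + k + + 4 * + j) (+ j) (+ k - + 4 * + j) (+ n - binom₂ (+ k - + 4 * + j))))
    ≡⟨ sumTo-cong (k / 4) (λ j → cong (λ N₂ → + p̄ 4 (+ N) N₂ (+ j) (+ k - + 4 * + j) (+ n - binom₂ (+ k - + 4 * + j)))
         (regroup (+ N) (+ k) (+ 4 * + j))) ⟩
  sumTo (k / 4) (λ j → leftTerm N (suc N) (+ n) j (+ k - + 4 * + j))
    ≡⟨ ∑-bound 4 (leftTerm N (suc N) (+ n)) (leftTerm-vanishing N (suc N) (+ n)) (k / 4) (+ k) (k<d[1+k/d] k 4) ⟩
  left N (suc N) (+ k) (+ n)
    ≡⟨ left≡right N (+ k) (+ n) ⟩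
  right N N (+ k) (+ n)
    ≡⟨ ∑-bound 2 (rightTerm N N (+ n)) (rightTerm-vanishing N N (+ n)) (k / 2) (+ k) (k<d[1+k/d] k 2) ⟨
  (Σ[ j ≤ k / 2 ] (-1ℤ ^ j * + p̄ 2 (+ N) (+ N) (+ j) (+ k - + 2 * + j) (+ n))) ∎
  where
  regroup : ∀ N k x → N + 1ℤ - k + x ≡ 1ℤ + N - (k - x)
  regroup = solve-∀
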